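{- Let $0< \varepsilon \le 1/2$ and $k \in \mathbb{N}$. Every edge-coloured bipartite graph $G$ on $n \ge (3+ \varepsilon)k + \varepsilon^{ -2}$ vertices with $\delta^c(G) \geq k$ contains a rainbow matching of size $k$.
   Context: Graphs are simple. An edge-coloured graph is a graph in which each edge is assigned a colour (not necessarily properly). A subgraph is rainbow if all its edges have distinct colours. For a vertex $v$, the colour degree $d^c(v)$ is the number of distinct colours on the edges incident with $v$; $\delta^c(G)=\min_{v\in V(G)} d^c(v)$.
   Formalization: The formal statement takes ε to be a rational number with 0 < ε ≤ 1/2, where the English allows any real ε in that range. -}

module Defs where

open import Data.Nat as ℕ using (ℕ; _≤_)
open import Data.Fin using (Fin)
open import Data.Bool using (Bool; true; false)
open import Data.List using (List; length; map; filter; deduplicate; allFin)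
open import Data.Product using (Σ; _×_; _,_)
open import Data.Rational as ℚ using (ℚ; 0ℚ; _<_; 1/_; _*_; positive)
open import Data.Rational.Properties using (pos⇒nonZero)
open import Function.Definitions using (Injective)
open import Relation.Binary.PropositionalEquality using (_≡_; _≢_)
open import Data.Bool using (T?)

-- An edge-coloured simple graph on vertex set Fin n.
-- adj u v = true  iff  uv is an edge; col u v is the colour of the edge uv
-- (colours are natural numbers; its values on non-edges are irrelevant).
record ECGraph (n : ℕ) : Set where
  field
    adj      : Fin n → Fin n → Bool
    col      : Fin n → Fin n → ℕ
    adj-sym  : ∀ u v → adj u v ≡ adj v u
    adj-irr  : ∀ v → adj v v ≡ false
    col-sym  : ∀ u v → col u v ≡ col v u
open ECGraph public

IsBipartite : ∀ {n} → ECGraph n → Set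
IsBipartite {n} G =
  Σ (Fin n → Bool) λ side → ∀ u v → adj G u v ≡ true → side u ≢ side v

neighbours : ∀ {n} → ECGraph n → Fin n → List (Fin n)
neighbours {n} G v = filter (λ u → T? (adj G v u)) (allFin n)

colourDegree : ∀ {n} → ECGraph n → Fin n → ℕ
colourDegree G v = length (deduplicate ℕ._≟_ (map (col G v) (neighbours G v)))

MinColourDegreeAtLeast : ∀ {n} → ECGraph n → ℕ → Set
MinColourDegreeAtLeast {n} G k = ∀ (v : Fin n) → k ≤ colourDegree G v

record RainbowMatching {n} (G : ECGraph n) (k : ℕ) : Set where
  field
    a b       : Fin k → Fin n
    isEdge    : ∀ i → adj G (a i) (b i) ≡ true
    a-inj     : Injective _≡_ _≡_ a
    b-inj     : Injective _≡_ _≡_ b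
    a≢b       : ∀ i j → a i ≢ b j
    rainbow   : Injective _≡_ _≡_ (λ i → col G (a i) (b i))

invSq : (ε : ℚ) → 0ℚ < ε → ℚ
invSq ε h = i * i
  where
  i : ℚ
  i = (1/ ε) {{pos⇒nonZero ε {{positive h}}}}

{-# OPTIONS --safe #-}
-- Already n ≥ 3k suffices. Let M be a rainbow matching of size m < k. Greedily choose
-- edges a b of M together with distinct pendant edges a z, z outside M, such that the colour
-- of each pendant edge is missing from M or is that of an edge chosen earlier. Moving a
-- chain of chosen edges to their pendants frees the colour of any chosen edge. As
-- n ≥ 3m + 3, some two vertices w, w′ on the same side avoid M and all z. For a
-- maximal choice without augmentation, an edge at w whose colour is missing or
-- chosen ends in a, b or z for some chosen edge, where a lies on one side and b, z
-- on the other; and the cross pair w b, w′ z would augment M. Hence each edge of M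
-- accounts for at most two of the 2(m + 1) differently coloured edges at w and
-- at w′, a contradiction.
module Submission where

open import Defs
open import Data.Nat using (ℕ)
open import Data.Integer using (+_)
open import Data.Rational using (ℚ; 0ℚ; _<_; _≤_; _+_; _*_; _/_)

open import Data.Bool as Bool using (Bool; true; false; not; T?)
open import Data.Bool.Properties using (¬-not; not-injective; T-≡)
open import Data.Fin as Fin using (Fin; zero; suc)
import Data.Fin.Properties as Fin
import Data.Integer as ℤ
import Data.Integer.Properties as ℤ
open import Data.List using (List; []; _∷_; _++_; length; allFin; lookup; map; tabulate; deduplicate)
import Data.List.Membership.DecPropositional as DecMembership
open import Data.List.Membership.Propositional using (_∈_; _∉_)
open import Data.List.Membership.Propositional.Properties
  using (∈-lookup; ∈-filter⁻; ∈-map⁺; ∈-map⁻; ∈-deduplicate⁻; ∈-tabulate⁺; ∈-++⁺ˡ; ∈-++⁺ʳ)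
import Data.List.Properties as List
open import Data.List.Relation.Binary.Subset.Propositional using (_⊆_)
open import Data.List.Relation.Unary.All as All using ([]; _∷_)
open import Data.List.Relation.Unary.All.Properties using (¬Any⇒All¬)
open import Data.List.Relation.Unary.AllPairs using ([]; _∷_)
open import Data.List.Relation.Unary.Any as Any using (here; there)
open import Data.List.Relation.Unary.Any.Properties using (lookup-index)
import Data.List.Relation.Unary.Unique.DecPropositional.Properties as DecUnique
open import Data.List.Relation.Unary.Unique.Propositional using (Unique)
import Data.Nat as ℕ
import Data.Nat.Properties as ℕ
open import Data.Nat.Tactic.RingSolver using (solve-∀)
open import Data.Product using (Σ; ∃; ∃₂; _×_; _,_; proj₁; proj₂)
import Data.Rational as ℚ
import Data.Rational.Properties as ℚ
import Data.Rational.Unnormalised as ℚᵘ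
import Data.Rational.Unnormalised.Properties as ℚᵘ
open import Data.Sum using (_⊎_; inj₁; inj₂; [_,_]′)
import Data.Sum.Effectful.Left as Left
open import Data.Vec.Functional using (updateAt) renaming (_∷_ to _∷ᵛ_)
open import Data.Vec.Functional.Properties using (updateAt-updates; updateAt-minimal)
open import Function using (_∘_; id; const; Injective)
open import Function.Bundles using (Equivalence)
open import Level using (0ℓ)
open import Relation.Binary.PropositionalEquality
  using (_≡_; _≢_; refl; sym; trans; cong; subst; subst₂; ≢-sym)
open import Relation.Nullary using (¬_; Dec; yes; no; contradiction)
open import Relation.Nullary.Decidable using (_⊎-dec_)

-- Lists of distinct entries and the pigeonhole principle.

lookup-injective : ∀ {A : Set} {xs : List A} → Unique xs → Injective _≡_ _≡_ (lookup xs)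
lookup-injective (_ ∷ _) {zero}  {zero}  _ = refl
lookup-injective {xs = _ ∷ xs} (x∉ ∷ _) {zero} {suc j} eq =
  contradiction eq (All.lookup x∉ (∈-lookup {xs = xs} j))
lookup-injective {xs = _ ∷ xs} (x∉ ∷ _) {suc i} {zero} eq =
  contradiction (sym eq) (All.lookup x∉ (∈-lookup {xs = xs} i))
lookup-injective (_ ∷ xs!) {suc i} {suc j} eq = cong suc (lookup-injective xs! eq)

Unique⇒length≤ : ∀ {m} {xs : List (Fin m)} → Unique xs → length xs ℕ.≤ m
Unique⇒length≤ xs! = Fin.injective⇒≤ (lookup-injective xs!)

infix 4 _∈?_
_∈?_ : ∀ {n} (i : Fin n) (xs : List (Fin n)) → Dec (i ∈ xs)
_∈?_ = DecMembership._∈?_ Fin._≟_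

fresh : ∀ {n} (xs : List (Fin n)) → length xs ℕ.< n → ∃ λ v → v ∉ xs
fresh {n} xs ∣xs∣<n = Fin.¬∀⟶∃¬ n (_∈ xs) (_∈? xs) λ all →
  ℕ.<⇒≱ ∣xs∣<n (Fin.injective⇒≤ {f = Any.index ∘ all} λ {u} {v} eq →
    trans (lookup-index (all u)) (trans (cong (lookup xs) eq) (sym (lookup-index (all v)))))

-- The summands on the left will be the edges at two vertices, those on the right the two values of
-- a flag.
pigeonhole-⊎ : ∀ {m} (g : Fin (ℕ.suc m) ⊎ Fin (ℕ.suc m) → Fin m ⊎ Fin m) →
               ∃₂ λ x y → x ≢ y × g x ≡ g y
pigeonhole-⊎ {m} g
  with Fin.pigeonhole (ℕ.+-mono-< (ℕ.n<1+n m) (ℕ.n<1+n m)) (Fin.join m m ∘ g ∘ Fin.splitAt (ℕ.suc m))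
... | x , y , x<y , same = Fin.splitAt (ℕ.suc m) x , Fin.splitAt (ℕ.suc m) y
  , (λ eq → Fin.<⇒≢ x<y (trans (sym (Fin.join-splitAt (ℕ.suc m) (ℕ.suc m) x))
      (trans (cong (Fin.join (ℕ.suc m) (ℕ.suc m)) eq) (Fin.join-splitAt (ℕ.suc m) (ℕ.suc m) y))))
  , trans (sym (Fin.splitAt-join m m _)) (trans (cong (Fin.splitAt m) same) (Fin.splitAt-join m m _))

-- Paths of colour exchanges.

-- If index i moves from its edge of colour κ i to a spare edge of colour κ′ i,
-- then κ i is released and κ′ i consumed. A path lists, last released first,
-- the indices to move in order to trade the colour c₀ for another one.
data Path {m} (κ κ′ : Fin m → ℕ) (P : List (Fin m)) (c₀ : ℕ) : ℕ → List (Fin m) → Set where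
  stop : Path κ κ′ P c₀ c₀ []
  move : ∀ {c i L} → i ∈ P → i ∉ L → c ≡ κ i → Path κ κ′ P c₀ (κ′ i) L → Path κ κ′ P c₀ c (i ∷ L)

module _ {m} {κ κ′ : Fin m → ℕ} {P : List (Fin m)} where

  path⊆ : ∀ {c₀ c L} → Path κ κ′ P c₀ c L → L ⊆ P
  path⊆ (move i∈P _ _ p) (here refl) = i∈P
  path⊆ (move _   _ _ p) (there j∈L) = path⊆ p j∈L

  -- Agreement of the pendant colours is asked on `P` only, because `grow` changes the one at the
  -- new index.
  path-map : ∀ {λ′ λ′′ : Fin m → ℕ} {Q c₀ c L} → P ⊆ Q →
             (∀ i → λ′ i ≡ κ i) → (∀ {i} → i ∈ P → λ′′ i ≡ κ′ i) →
             Path κ κ′ P c₀ c L → Path λ′ λ′′ Q c₀ c L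
  path-map P⊆Q eq eq′ stop = stop
  path-map P⊆Q eq eq′ (move {i = i} i∈P i∉L c≡ p) =
    move (P⊆Q i∈P) i∉L (trans c≡ (sym (eq i)))
      (subst (λ c → Path _ _ _ _ c _) (sym (eq′ i∈P)) (path-map P⊆Q eq eq′ p))

  path-from : ∀ {c₀ c L i} → Path κ κ′ P c₀ c L → i ∈ L →
              ∃ λ K → Path κ κ′ P c₀ (κ i) K × K ⊆ L
  path-from p@(move i∈P i∉L c≡ q) (here refl) = _ , move i∈P i∉L refl q , id
  path-from (move _ _ _ p) (there i∈L) with path-from p i∈L
  ... | K , q , K⊆L = K , q , there ∘ K⊆L

  -- Cuts the path at `j`: once `κ j` has been released by other means, the moves that came after
  -- `j` still release `c`.
  path-until : ∀ {c₀ c L j} → Path κ κ′ P c₀ c L → j ∈ L →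
               ∃ λ K → Path κ κ′ P (κ j) c K × j ∉ K × K ⊆ L
  path-until (move _ _ refl p) (here refl) = [] , stop , (λ ()) , λ ()
  path-until {j = j} (move {i = i} i∈P i∉L c≡ p) (there j∈L) with path-until p j∈L
  ... | K , q , j∉K , K⊆L =
    i ∷ K , move i∈P (i∉L ∘ K⊆L) c≡ q
    , (λ { (here refl) → i∉L j∈L ; (there j∈K) → j∉K j∈K })
    , λ { (here eq) → here eq ; (there x) → there (K⊆L x) }

  module _ (κ-inj : Injective _≡_ _≡_ κ) {c₀} (c₀-free : ∀ i → κ i ≢ c₀) where

    -- As `κ` is injective, a held colour determines the next index, so the two paths agree from `c`
    -- onwards. The second cannot stop before the first does, since `c₀` is held by no index; it
    -- therefore continues through `j`.
    path-through : ∀ {j c K L} → Path κ κ′ P (κ j) c K → Path κ κ′ P c₀ c L → j ∈ L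
    path-through stop stop = contradiction refl (c₀-free _)
    path-through stop (move _ _ κj≡κi _) = here (κ-inj κj≡κi)
    path-through (move _ _ c≡ _) stop = contradiction (sym c≡) (c₀-free _)
    path-through (move _ _ c≡ p) (move _ _ c≡′ q) with κ-inj (trans (sym c≡) c≡′)
    ... | refl = there (path-through p q)

    -- From a common index both paths go on from the same colour, and `path-through` would put `j`
    -- in `L`.
    path-disjoint : ∀ {j c c′ K L i} → Path κ κ′ P (κ j) c K → Path κ κ′ P c₀ c′ L → j ∉ L →
                    i ∈ K → i ∉ L
    path-disjoint p q j∉L i∈K i∈L with path-from p i∈K | path-from q i∈L
    ... | _ , p′ , _ | _ , q′ , L′⊆L = j∉L (L′⊆L (path-through p′ q′))

-- Rainbow matchings: adding and replacing an edge.

module Rainbow {n} (G : ECGraph n) where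

  Edge : Set
  Edge = Fin n × Fin n

  IsEdge : Edge → Set
  IsEdge (u , v) = adj G u v ≡ true

  colour : Edge → ℕ
  colour (u , v) = col G u v

  infix 4 _∉ᵉ_
  _∉ᵉ_ : Fin n → Edge → Set
  x ∉ᵉ e = x ≢ proj₁ e × x ≢ proj₂ e

  Apart : Edge → Edge → Set
  Apart e f = (proj₁ e ∉ᵉ f) × (proj₂ e ∉ᵉ f) × colour e ≢ colour f

  Apart-sym : ∀ {e f} → Apart e f → Apart f e
  Apart-sym ((p , q) , (r , s) , t) = (≢-sym p , ≢-sym r) , (≢-sym q , ≢-sym s) , ≢-sym t

  loopless : ∀ {u v} → adj G u v ≡ true → u ≢ v
  loopless {u} uv refl with trans (sym uv) (adj-irr G u)
  ... | ()

  record Matching (m : ℕ) : Set where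
    field
      edge   : Fin m → Edge
      isEdge : ∀ i → IsEdge (edge i)
      apart  : ∀ {i j} → i ≢ j → Apart (edge i) (edge j)

    κ : Fin m → ℕ
    κ i = colour (edge i)

    κ-injective : Injective _≡_ _≡_ κ
    κ-injective {i} {j} eq with i Fin.≟ j
    ... | yes i≡j = i≡j
    ... | no  i≢j = contradiction eq (proj₂ (proj₂ (apart i≢j)))

    Free : Fin n → Set
    Free v = ∀ i → v ∉ᵉ edge i

    FreeColour : ℕ → Set
    FreeColour c = ∀ i → κ i ≢ c

  open Matching

  toRainbowMatching : ∀ {m} → Matching m → RainbowMatching G m
  toRainbowMatching M = record
    { a       = proj₁ ∘ edge M
    ; b       = proj₂ ∘ edge M
    ; isEdge  = isEdge M
    ; a-inj   = λ {i} {j} → contra λ i≢j → proj₁ (proj₁ (apart M i≢j))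
    ; b-inj   = λ {i} {j} → contra λ i≢j → proj₂ (proj₁ (proj₂ (apart M i≢j)))
    ; a≢b     = a≢b
    ; rainbow = κ-injective M
    }
    where
    contra : ∀ {i j} {A : Set} → (i ≢ j → ¬ A) → A → i ≡ j
    contra {i} {j} h x with i Fin.≟ j
    ... | yes i≡j = i≡j
    ... | no  i≢j = contradiction x (h i≢j)
    a≢b : ∀ i j → proj₁ (edge M i) ≢ proj₂ (edge M j)
    a≢b i j with i Fin.≟ j
    ... | yes refl = loopless (isEdge M i)
    ... | no  i≢j  = proj₂ (proj₁ (apart M i≢j))

  extend : ∀ {m} (M : Matching m) (f : Edge) → IsEdge f → (∀ i → Apart f (edge M i)) →
           Matching (ℕ.suc m)
  extend M f f-edge f-apart = record { edge = f ∷ᵛ edge M ; isEdge = is ; apart = ap _ _ }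
    where
    is : ∀ i → IsEdge ((f ∷ᵛ edge M) i)
    is zero    = f-edge
    is (suc i) = isEdge M i
    ap : ∀ i j → i ≢ j → Apart ((f ∷ᵛ edge M) i) ((f ∷ᵛ edge M) j)
    ap zero    zero    i≢j = contradiction refl i≢j
    ap zero    (suc j) _   = f-apart j
    ap (suc i) zero    _   = Apart-sym {f} (f-apart i)
    ap (suc i) (suc j) i≢j = apart M (i≢j ∘ cong suc)

  record Replacement {m} (M : Matching m) (i : Fin m) (f : Edge) : Set where
    field
      result : Matching m
      at     : edge result i ≡ f
      off    : ∀ {j} → j ≢ i → edge result j ≡ edge M j

    releases : FreeColour M (colour f) → FreeColour result (κ M i)
    releases free j κj≡ with j Fin.≟ i
    ... | yes refl = free i (trans (sym κj≡) (cong colour at))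
    ... | no  j≢i  = proj₂ (proj₂ (apart M j≢i)) (trans (cong colour (sym (off j≢i))) κj≡)

    still-free : ∀ {v} → v ∉ᵉ f → (∀ {j} → j ≢ i → v ∉ᵉ edge M j) → Free result v
    still-free {v} v∉f v∉M j with j Fin.≟ i
    ... | yes refl = subst (v ∉ᵉ_) (sym at) v∉f
    ... | no  j≢i  = subst (v ∉ᵉ_) (sym (off j≢i)) (v∉M j≢i)

  replace : ∀ {m} (M : Matching m) (i : Fin m) (f : Edge) → IsEdge f →
            (∀ {j} → j ≢ i → Apart f (edge M j)) → Replacement M i f
  replace M i f f-edge f-apart = record
    { result = record { edge = e ; isEdge = is ; apart = ap }
    ; at     = e-at
    ; off    = e-off
    }
    where
    e = updateAt (edge M) i (const f)
    e-at : e i ≡ f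
    e-at = updateAt-updates i (edge M)
    e-off : ∀ {j} → j ≢ i → e j ≡ edge M j
    e-off {j} = updateAt-minimal j i (edge M)
    is : ∀ j → IsEdge (e j)
    is j with j Fin.≟ i
    ... | yes refl = subst IsEdge (sym e-at) f-edge
    ... | no  j≢i  = subst IsEdge (sym (e-off j≢i)) (isEdge M j)
    ap : ∀ {j k} → j ≢ k → Apart (e j) (e k)
    ap {j} {k} j≢k with j Fin.≟ i | k Fin.≟ i
    ... | yes refl | yes refl = contradiction refl j≢k
    ... | yes refl | no  k≢i  = subst₂ Apart (sym e-at) (sym (e-off k≢i)) (f-apart k≢i)
    ... | no  j≢i  | yes refl = subst₂ Apart (sym (e-off j≢i)) (sym e-at) (Apart-sym {f} (f-apart j≢i))
    ... | no  j≢i  | no  k≢i  = subst₂ Apart (sym (e-off j≢i)) (sym (e-off k≢i)) (apart M j≢k)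

  -- Forests of pendant edges.

  -- Each index in P carries a pendant edge joining the first end of its matching
  -- edge to a free vertex z; each of these matching edges can be traded, by
  -- moving to pendant edges, for an edge in a colour missing from the matching.
  record Forest (m : ℕ) : Set where
    field
      matching : Matching m
      P        : List (Fin m)
      P-unique : Unique P
      z        : Fin m → Fin n

    a : Fin m → Fin n
    a i = proj₁ (edge matching i)

    b : Fin m → Fin n
    b i = proj₂ (edge matching i)

    pendant : Fin m → Edge
    pendant i = a i , z i

    -- Moving the indices in `L` makes `c` a missing colour; the empty chain covers the colours
    -- already missing.
    Chain : ℕ → List (Fin m) → Set
    Chain c L = ∃ λ c₀ → FreeColour matching c₀ × Path (κ matching) (colour ∘ pendant) P c₀ c L

    field
      z-free : ∀ {i} → i ∈ P → Free matching (z i)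
      z-inj  : ∀ {i j} → i ∈ P → j ∈ P → z i ≡ z j → i ≡ j
      z-edge : ∀ {i} → i ∈ P → IsEdge (pendant i)
      chains : ∀ {i} → i ∈ P → ∃ (Chain (κ matching i))

    -- All values of `z` are avoided, including those at indices outside `P`, so at most 3m vertices
    -- are excluded whatever `P` is.
    Fresh : Fin n → Set
    Fresh w = Free matching w × (∀ i → w ≢ z i)

  -- Augmenting along chains.

  module _ {m} (F : Forest m) where

    open Forest F

    -- The initial matching `N` is a parameter because `augment-bz` follows a second path in a
    -- matching that a first chain has already altered.
    record Moved (N : Matching m) (c : ℕ) (L : List (Fin m)) : Set where
      field
        result : Matching m
        colour-free : FreeColour result c
        on  : ∀ {i} → i ∈ L → edge result i ≡ pendant i
        off : ∀ {i} → i ∉ L → edge result i ≡ edge N i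

      avoids : ∀ {v} → (∀ {i} → i ∈ L → v ∉ᵉ pendant i) → (∀ {i} → i ∉ L → v ∉ᵉ edge N i) →
               Free result v
      avoids {v} v∉on v∉off i with i ∈? L
      ... | yes i∈L = subst (v ∉ᵉ_) (sym (on i∈L)) (v∉on i∈L)
      ... | no  i∉L = subst (v ∉ᵉ_) (sym (off i∉L)) (v∉off i∉L)

    -- The tail of the path is carried out first. It releases the colour of the pendant edge of `i`,
    -- so `i` can move there, which in turn releases `κ i`.
    moveAlong : ∀ {N c₀ c L} → Path (κ matching) (colour ∘ pendant) P c₀ c L → FreeColour N c₀ →
                (∀ {i} → i ∈ L → edge N i ≡ edge matching i × Free N (z i)) → Moved N c L
    moveAlong {N} stop c₀-free _ = record
      { result = N ; colour-free = c₀-free ; on = λ () ; off = λ _ → refl }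
    moveAlong {N} {L = i ∷ L} (move i∈P i∉L refl p) c₀-free base = record
      { result      = result R
      ; colour-free = λ j eq → releases R (Moved.colour-free S) j (trans eq (sym (cong colour same)))
      ; on          = λ { (here refl) → at R
                        ; (there j∈L) → trans (off R (λ { refl → i∉L j∈L })) (Moved.on S j∈L) }
      ; off         = λ {j} j∉ → trans (off R (j∉ ∘ here)) (Moved.off S (j∉ ∘ there))
      }
      where
      open Replacement
      S = moveAlong {N} p c₀-free (base ∘ there)
      same : edge (Moved.result S) i ≡ edge matching i
      same = trans (Moved.off S i∉L) (proj₁ (base (here refl)))
      z-avoids : Free (Moved.result S) (z i)
      z-avoids = Moved.avoids S
        (λ j∈L → proj₁ (z-free i∈P _)
               , λ eq → i∉L (subst (_∈ L) (sym (z-inj i∈P (path⊆ p j∈L) eq)) j∈L))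
        (λ _ → proj₂ (base (here refl)) _)
      R = replace (Moved.result S) i (pendant i) (z-edge i∈P) λ {j} j≢i →
            subst (λ e → proj₁ e ∉ᵉ edge (Moved.result S) j) same
              (proj₁ (apart (Moved.result S) (≢-sym j≢i)))
          , z-avoids j
          , ≢-sym (Moved.colour-free S j)

    free-chain : ∀ {c L} → Chain c L → Moved matching c L
    free-chain (_ , c₀-free , p) = moveAlong p c₀-free λ i∈L → refl , z-free (path⊆ p i∈L)

    Fresh-avoids : ∀ {w i} → Fresh w → w ∉ᵉ pendant i
    Fresh-avoids (w∉M , w≢z) = proj₁ (w∉M _) , w≢z _

    -- After the moves the colour of `(w , u)` is missing and `w` is still unmatched, so only `u`
    -- has to be checked, against the edges kept and the pendant edges moved onto.
    augment : ∀ {w u L} → Fresh w → IsEdge (w , u) → Chain (col G w u) L →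
              (∀ {i} → i ∉ L → u ∉ᵉ edge matching i) → (∀ {i} → i ∈ L → u ∉ᵉ pendant i) →
              Matching (ℕ.suc m)
    augment {w} {u} w-fresh wu ch u∉off u∉on =
      extend result (w , u) wu λ i →
        avoids (λ _ → Fresh-avoids w-fresh) (λ _ → proj₁ w-fresh _) i
      , avoids u∉on u∉off i
      , ≢-sym (colour-free i)
      where open Moved (free-chain ch)

    b∉pendant : ∀ {i j} → i ∈ P → b j ∉ᵉ pendant i
    b∉pendant {i} {j} i∈P = b≢a , ≢-sym (proj₂ (z-free i∈P j))
      where
      b≢a : b j ≢ a i
      b≢a with i Fin.≟ j
      ... | yes refl = ≢-sym (loopless (isEdge matching i))
      ... | no  i≢j  = ≢-sym (proj₂ (proj₁ (apart matching i≢j)))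

    chain⊆ : ∀ {c L} → Chain c L → L ⊆ P
    chain⊆ (_ , _ , p) = path⊆ p

    -- A chain avoiding `j` leaves `z j` unmatched.
    augment-z : ∀ {w j L} → Fresh w → IsEdge (w , z j) → Chain (col G w (z j)) L →
                j ∈ P → j ∉ L → Matching (ℕ.suc m)
    augment-z w-fresh wz ch j∈P j∉L = augment w-fresh wz ch
      (λ _ → z-free j∈P _)
      (λ i∈L → proj₁ (z-free j∈P _)
             , λ eq → j∉L (subst (_∈ _) (sym (z-inj j∈P (chain⊆ ch i∈L) eq)) i∈L))

    -- A chain through `j` moves its matching edge to the pendant edge and so uncovers `b j`.
    augment-b : ∀ {w j L} → Fresh w → IsEdge (w , b j) → Chain (col G w (b j)) L →
                j ∈ L → Matching (ℕ.suc m)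
    augment-b w-fresh wb ch j∈L = augment w-fresh wb ch
      (λ i∉L → proj₁ (proj₂ (apart matching λ { refl → i∉L j∈L })))
      (λ i∈L → b∉pendant (chain⊆ ch i∈L))

    -- Release the colour of (w , b j), move index j onto that edge, and then
    -- follow the part of the second chain above j to release the colour of (w′ , z j).
    augment-bz : ∀ {w w′ j L L′} → Fresh w → Fresh w′ → w ≢ w′ →
                 IsEdge (w , b j) → Chain (col G w (b j)) L → j ∈ P → j ∉ L →
                 IsEdge (w′ , z j) → Chain (col G w′ (z j)) L′ → j ∈ L′ →
                 Matching (ℕ.suc m)
    augment-bz {w} {w′} {j} {L} w-fresh w′-fresh w≢w′ wb ch@(_ , c₀-free , p) j∈P j∉L
               w′z ch′@(_ , _ , p′) j∈L′ with path-until p′ j∈L′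
    ... | K , q , j∉K , K⊆L′ = extend (Moved.result T) (w′ , z j) w′z λ i →
            Moved.avoids T (λ _ → Fresh-avoids w′-fresh) (λ _ → w′-free _) i
          , Moved.avoids T (λ i∈K → proj₁ (z-free j∈P _)
                                  , λ eq → j∉K (subst (_∈ K) (sym (z-inj j∈P (K⊆P i∈K) eq)) i∈K))
                           (λ _ → zj-free _) i
          , ≢-sym (Moved.colour-free T i)
      where
      open Replacement
      S = free-chain ch
      N = Moved.result S
      K⊆P : K ⊆ P
      K⊆P = chain⊆ ch′ ∘ K⊆L′
      -- The first chain has therefore left the matching edges of `K` in place and their pendant
      -- ends unmatched.
      K∩L : ∀ {i} → i ∈ K → i ∉ L
      K∩L = path-disjoint (κ-injective matching) c₀-free q p j∉L

      ej : edge N j ≡ edge matching j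
      ej = Moved.off S j∉L
      w-avoids : Free N w
      w-avoids = Moved.avoids S (λ _ → Fresh-avoids w-fresh) (λ _ → proj₁ w-fresh _)
      R : Replacement N j (w , b j)
      R = replace N j (w , b j) wb λ {i} i≢j →
            w-avoids i
          , subst (λ e → proj₂ e ∉ᵉ edge N i) ej (proj₁ (proj₂ (apart N (≢-sym i≢j))))
          , ≢-sym (Moved.colour-free S i)
      w′-free : Free (result R) w′
      w′-free = still-free R (≢-sym w≢w′ , proj₂ (proj₁ w′-fresh j)) λ {i} _ →
        Moved.avoids S (λ _ → Fresh-avoids w′-fresh) (λ _ → proj₁ w′-fresh _) i
      z-free-after : ∀ {i} → i ∈ P → i ∉ L → Free (result R) (z i)
      z-free-after {i} i∈P i∉L = still-free R (≢-sym (proj₂ w-fresh i) , proj₂ (z-free i∈P j)) λ {k} _ →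
        Moved.avoids S
          (λ l∈L → proj₁ (z-free i∈P _)
                 , λ eq → i∉L (subst (_∈ L) (sym (z-inj i∈P (chain⊆ ch l∈L) eq)) l∈L))
          (λ _ → z-free i∈P _) k
      zj-free : Free (result R) (z j)
      zj-free = z-free-after j∈P j∉L
      T : Moved (result R) (col G w′ (z j)) K
      T = moveAlong q
            (λ i eq → releases R (Moved.colour-free S) i (trans eq (sym (cong colour ej))))
            λ i∈K → trans (off R λ { refl → j∉K i∈K }) (Moved.off S (K∩L i∈K))
                  , z-free-after (K⊆P i∈K) (K∩L i∈K)

  -- Growing a forest.

  -- Adding j to P may require exchanging the ends of its matching edge, so that
  -- the end u carrying the pendant edge comes first.
  grow : ∀ {m} (F : Forest m) → let open Forest F in
         ∀ {j u v w L} → j ∉ P → Fresh w → IsEdge (w , u) → Chain (col G w u) L →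
         edge matching j ≡ (u , v) ⊎ edge matching j ≡ (v , u) →
         Σ (Forest m) λ F′ → length (Forest.P F′) ≡ ℕ.suc (length P)
  grow {m} F {j} {u} {v} {w} {L} j∉P (w-free , w≢z) wu ch ends = F′ , refl
    where
    open Forest F
    M = matching

    oriented : (e : Edge) → e ≡ (u , v) ⊎ e ≡ (v , u) → IsEdge e → (∀ {i} → i ≢ j → Apart e (edge M i)) →
               IsEdge (u , v) × (∀ {i} → i ≢ j → Apart (u , v) (edge M i)) × col G u v ≡ colour e
    oriented e (inj₁ refl) e-edge e-apart = e-edge , e-apart , refl
    oriented e (inj₂ refl) e-edge e-apart =
      trans (adj-sym G u v) e-edge
      , (λ {i} i≢j → let (p , q , r) = e-apart i≢j in q , p , subst (_≢ κ M i) (col-sym G v u) r)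
      , col-sym G u v

    uv = oriented (edge M j) ends (isEdge M j) (λ i≢j → apart M (≢-sym i≢j))
    R = replace M j (u , v) (proj₁ uv) (proj₁ (proj₂ uv))
    open Replacement R

    z′ : Fin m → Fin n
    z′ = updateAt z j (const w)
    z′-at : z′ j ≡ w
    z′-at = updateAt-updates j z
    z′-off : ∀ {i} → i ≢ j → z′ i ≡ z i
    z′-off {i} = updateAt-minimal i j z

    old≢ : ∀ {i} → i ∈ P → i ≢ j
    old≢ i∈P refl = j∉P i∈P

    -- Turning an edge around keeps its colour, so missing colours and existing chains carry over.
    κ-same : ∀ i → κ result i ≡ κ M i
    κ-same i with i Fin.≟ j
    ... | yes refl = trans (cong colour at) (proj₂ (proj₂ uv))
    ... | no  i≢j  = cong colour (off i≢j)

    pendant′ : Fin m → Edge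
    pendant′ i = proj₁ (edge result i) , z′ i
    pendant′-at : pendant′ j ≡ (u , w)
    pendant′-at = trans (cong (λ e → proj₁ e , z′ j) at) (cong (u ,_) z′-at)
    pendant′-off : ∀ {i} → i ≢ j → pendant′ i ≡ pendant i
    pendant′-off {i} i≢j = trans (cong (λ e → proj₁ e , z′ i) (off i≢j)) (cong (a i ,_) (z′-off i≢j))

    Chain′ : ℕ → List (Fin m) → Set
    Chain′ c K = ∃ λ c₀ → FreeColour result c₀ × Path (κ result) (colour ∘ pendant′) (j ∷ P) c₀ c K
    weaken : ∀ {c K} → Chain c K → Chain′ c K
    weaken (c₀ , c₀-free , p) =
      c₀ , (λ i eq → c₀-free i (trans (sym (κ-same i)) eq))
      , path-map there κ-same (λ i∈P → cong colour (pendant′-off (old≢ i∈P))) p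

    stays-free : ∀ {x} → Free M x → Free result x
    stays-free {x} x-free = still-free (x≢ ends (x-free j)) (λ {i} _ → x-free i)
      where
      x≢ : ∀ {e} → e ≡ (u , v) ⊎ e ≡ (v , u) → x ∉ᵉ e → x ∉ᵉ (u , v)
      x≢ (inj₁ refl) x∉e = x∉e
      x≢ (inj₂ refl) (p , q) = q , p

    z-free′ : ∀ {i} → i ∈ j ∷ P → Free result (z′ i)
    z-free′ (here refl) = subst (Free result) (sym z′-at) (stays-free w-free)
    z-free′ (there i∈P) = subst (Free result) (sym (z′-off (old≢ i∈P))) (stays-free (z-free i∈P))

    z-inj′ : ∀ {i k} → i ∈ j ∷ P → k ∈ j ∷ P → z′ i ≡ z′ k → i ≡ k
    z-inj′ (here refl) (here refl) _ = refl
    z-inj′ (here refl) (there k∈P) eq =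
      contradiction (trans (sym z′-at) (trans eq (z′-off (old≢ k∈P)))) (w≢z _)
    z-inj′ (there i∈P) (here refl) eq =
      contradiction (trans (sym z′-at) (trans (sym eq) (z′-off (old≢ i∈P)))) (w≢z _)
    z-inj′ (there i∈P) (there k∈P) eq =
      z-inj i∈P k∈P (trans (sym (z′-off (old≢ i∈P))) (trans eq (z′-off (old≢ k∈P))))

    z-edge′ : ∀ {i} → i ∈ j ∷ P → IsEdge (pendant′ i)
    z-edge′ (here refl) = subst IsEdge (sym pendant′-at) (trans (adj-sym G u w) wu)
    z-edge′ (there i∈P) = subst IsEdge (sym (pendant′-off (old≢ i∈P))) (z-edge i∈P)

    chains′ : ∀ {i} → i ∈ j ∷ P → ∃ (Chain′ (κ result i))
    -- The new pendant edge is `(w , u)` reversed, and `ch` releases its colour; moving `j`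
    -- afterwards releases the colour of `j`.
    chains′ (here refl) with weaken ch
    ... | c₀ , c₀-free , p = j ∷ L , c₀ , c₀-free
        , move (here refl) (j∉P ∘ chain⊆ F ch) refl
            (subst (λ c → Path (κ result) (colour ∘ pendant′) (j ∷ P) c₀ c L) (trans (col-sym G w u) (cong colour (sym pendant′-at))) p)
    chains′ {i} (there i∈P) with chains i∈P
    ... | K , ch′ = K , subst (λ c → Chain′ c K) (sym (κ-same i)) (weaken ch′)

    F′ : Forest m
    F′ = record
      { matching = result
      ; P        = j ∷ P
      ; P-unique = ¬Any⇒All¬ P j∉P ∷ P-unique
      ; z        = z′
      ; z-free   = z-free′
      ; z-inj    = z-inj′
      ; z-edge   = z-edge′
      ; chains   = chains′
      }

  -- Locating the edges at a fresh vertex.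

  module _ {m} (F : Forest m) where

    open Forest F

    -- The edge wu is assigned to an index: that of its colour when the colour
    -- is held outside P, and otherwise the one whose matching or pendant edge
    -- contains u. The flag marks u = z i.
    data Location (w u : Fin n) (i : Fin m) : Bool → Set where
      outside : i ∉ P → col G w u ≡ κ matching i → Location w u i false
      at-a    : i ∈ P → u ≡ a i → Location w u i false
      at-b    : ∀ {L} → i ∈ P → u ≡ b i → Chain (col G w u) L → i ∉ L → Location w u i false
      at-z    : ∀ {L} → i ∈ P → u ≡ z i → Chain (col G w u) L → i ∈ L → Location w u i true

    -- The inductive call on a forest with one more pendant edge, which `improve` supplies.
    Continuation : Set
    Continuation = ∀ (F′ : Forest m) → length (Forest.P F′) ≡ ℕ.suc (length P) → Matching (ℕ.suc m)

    -- Every other position of `u` gives progress: if the moves leave or make `u` unmatched, the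
    -- matching is augmented, and if `u` is an end of a matching edge outside `P`, the forest grows.
    locate-chain : Continuation →
                   ∀ {w u L} → Fresh w → IsEdge (w , u) → Chain (col G w u) L →
                   Matching (ℕ.suc m) ⊎ ∃₂ (Location w u)
    locate-chain continue {w} {u} {L} w-fresh wu ch with u ∈? map z P
    ... | yes u∈z with ∈-map⁻ z u∈z
    ...   | i , i∈P , refl with i ∈? L
    ...     | yes i∈L = inj₂ (i , true , at-z i∈P refl ch i∈L)
    ...     | no  i∉L = inj₁ (augment-z F w-fresh wu ch i∈P i∉L)
    locate-chain continue {w} {u} {L} w-fresh wu ch | no u∉z
      with Fin.any? (λ i → (u Fin.≟ a i) ⊎-dec (u Fin.≟ b i))
    ... | no u∉M = inj₁ (augment F w-fresh wu ch (λ {i} _ → avoids i)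
                           λ {i} i∈L → proj₁ (avoids i)
                                     , λ { refl → u∉z (∈-map⁺ z (chain⊆ F ch i∈L)) })
      where
      avoids : Free matching u
      avoids i = (λ eq → u∉M (i , inj₁ eq)) , (λ eq → u∉M (i , inj₂ eq))
    ... | yes (i , u≡) with i ∈? P | u≡
    ...   | yes i∈P | inj₁ u≡a = inj₂ (i , false , at-a i∈P u≡a)
    ...   | yes i∈P | inj₂ refl with i ∈? L
    ...     | yes i∈L = inj₁ (augment-b F w-fresh wu ch i∈L)
    ...     | no  i∉L = inj₂ (i , false , at-b i∈P refl ch i∉L)
    locate-chain continue {w} {u} {L} w-fresh wu ch | no u∉z | yes (i , u≡) | no i∉P | inj₁ refl =
      let (F′ , ∣F′∣) = grow F i∉P w-fresh wu ch (inj₁ refl) in inj₁ (continue F′ ∣F′∣)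
    locate-chain continue {w} {u} {L} w-fresh wu ch | no u∉z | yes (i , u≡) | no i∉P | inj₂ refl =
      let (F′ , ∣F′∣) = grow F i∉P w-fresh wu ch (inj₂ refl) in inj₁ (continue F′ ∣F′∣)

    -- A missing colour has the empty chain, and a colour held in `P` has the chain stored in the
    -- forest. A colour held outside `P` names the index directly.
    locate : Continuation →
             ∀ {w u} → Fresh w → IsEdge (w , u) →
             Matching (ℕ.suc m) ⊎ ∃₂ (Location w u)
    locate continue {w} {u} w-fresh wu with Fin.any? (λ i → κ matching i ℕ.≟ col G w u)
    ... | no  c-new = locate-chain continue w-fresh wu (_ , (λ i eq → c-new (i , eq)) , stop)
    ... | yes (i , κi≡) with i ∈? P
    ...   | no  i∉P = inj₂ (i , false , outside i∉P (sym κi≡))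
    ...   | yes i∈P = locate-chain continue w-fresh wu
                        (subst (λ c → Chain c _) κi≡ (proj₂ (chains i∈P)))

  -- Differently coloured edges at a vertex.

  record Spectrum (m : ℕ) (w : Fin n) : Set where
    field
      end       : Fin (ℕ.suc m) → Fin n
      end-edge  : ∀ s → IsEdge (w , end s)
      injective : Injective _≡_ _≡_ (λ s → col G w (end s))

  open Spectrum

  -- One edge is picked for each of the first m + 1 entries of the deduplicated list of colours at
  -- `w`.
  spectrum : ∀ {m w} → m ℕ.< colourDegree G w → Spectrum m w
  spectrum {m} {w} m<d = record
    { end       = λ s → proj₁ (pick s)
    ; end-edge  = λ s → proj₁ (proj₂ (pick s))
    ; injective = λ {s} {t} eq → Fin.inject≤-injective m<d m<d s t
        (lookup-injective (DecUnique.deduplicate-! ℕ._≟_ cs)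
          (trans (proj₂ (proj₂ (pick s))) (trans eq (sym (proj₂ (proj₂ (pick t)))))))
    }
    where
    cs = map (col G w) (neighbours G w)
    colours = deduplicate ℕ._≟_ cs
    pick : ∀ s → ∃ λ u → IsEdge (w , u) × lookup colours (Fin.inject≤ s m<d) ≡ col G w u
    pick s with ∈-map⁻ (col G w) (∈-deduplicate⁻ ℕ._≟_ cs (∈-lookup {xs = colours} (Fin.inject≤ s m<d)))
    ... | u , u∈ , eq = u , Equivalence.to T-≡ (proj₂ (∈-filter⁻ (λ v → T? (adj G w v)) {xs = allFin n} u∈)) , eq

  -- Counting edges at two fresh vertices on one side.

  module Bipartite (side : Fin n → Bool) (bipartite : ∀ u v → IsEdge (u , v) → side u ≢ side v) where

    same-side : ∀ {w w′ u u′} → side w ≡ side w′ → IsEdge (w , u) → IsEdge (w′ , u′) →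
                ¬ IsEdge (u , u′)
    same-side {w} {w′} {u} {u′} eq wu w′u′ uu′ = bipartite u u′ uu′ (not-injective
      (trans (sym (¬-not (bipartite w u wu))) (trans eq (¬-not (bipartite w′ u′ w′u′)))))

    module _ {m} (F : Forest m) where

      open Forest F

      -- Either both edges have the colour of index `i`, or they have the same end: `w` cannot be
      -- joined to both `a i` and `b i`, which lie on different sides.
      location-colour : ∀ {w u u′ i t} → Location F w u i t → Location F w u′ i t →
                        IsEdge (w , u) → IsEdge (w , u′) → col G w u ≡ col G w u′
      location-colour (outside _ c≡)   (outside _ c≡′)     _ _ = trans c≡ (sym c≡′)
      location-colour (outside i∉P _)  (at-a i∈P _)        _ _ = contradiction i∈P i∉P
      location-colour (outside i∉P _)  (at-b i∈P _ _ _)    _ _ = contradiction i∈P i∉P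
      location-colour (at-a i∈P _)     (outside i∉P _)     _ _ = contradiction i∈P i∉P
      location-colour (at-b i∈P _ _ _) (outside i∉P _)     _ _ = contradiction i∈P i∉P
      location-colour (at-a _ refl)    (at-a _ refl)       _ _ = refl
      location-colour (at-b _ refl _ _) (at-b _ refl _ _)  _ _ = refl
      location-colour (at-z _ refl _ _) (at-z _ refl _ _)  _ _ = refl
      location-colour {i = i} (at-a _ refl) (at-b _ refl _ _) wu wu′ =
        contradiction (isEdge matching i) (same-side refl wu wu′)
      location-colour {i = i} (at-b _ refl _ _) (at-a _ refl) wu wu′ =
        contradiction (isEdge matching i) (same-side refl wu′ wu)

      -- The edge at `w′` ends in `z i`, so `i` is in `P`, and `a i`, a neighbour of `z i`, cannot
      -- be the end of the edge at `w`. This leaves `b i`, the case of `augment-bz`.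
      location-clash : ∀ {w w′ u u′ i} → Fresh w → Fresh w′ → w ≢ w′ → side w ≡ side w′ →
                       IsEdge (w , u) → IsEdge (w′ , u′) →
                       Location F w u i false → Location F w′ u′ i true → Matching (ℕ.suc m)
      location-clash _ _ _ _ _ _ (outside i∉P _) (at-z i∈P _ _ _) = contradiction i∈P i∉P
      location-clash _ _ _ eq wu w′u′ (at-a i∈P refl) (at-z _ refl _ _) =
        contradiction (z-edge i∈P) (same-side eq wu w′u′)
      location-clash fr fr′ w≢w′ _ wu w′u′ (at-b i∈P refl ch i∉L) (at-z _ refl ch′ i∈L′) =
        augment-bz F fr fr′ w≢w′ wu ch i∈P i∉L w′u′ ch′ i∈L′

      module _ {w w′} (fr : Fresh w) (fr′ : Fresh w′) (w≢w′ : w ≢ w′) (eq : side w ≡ side w′)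
               (sp : Spectrum m w) (sp′ : Spectrum m w′)
               (loc : ∀ s → ∃₂ (Location F w (end sp s)))
               (loc′ : ∀ s → ∃₂ (Location F w′ (end sp′ s))) where

        place : Fin m × Bool → Fin m ⊎ Fin m
        place (i , false) = inj₁ i
        place (i , true)  = inj₂ i

        place-injective : Injective _≡_ _≡_ place
        place-injective {_ , false} {_ , false} refl = refl
        place-injective {_ , true}  {_ , true}  refl = refl

        -- With the flags of w′ flipped, two edges at different vertices in the
        -- same slot are exactly a pair to which location-clash applies.
        slot : Fin (ℕ.suc m) ⊎ Fin (ℕ.suc m) → Fin m × Bool
        slot (inj₁ s) = let (i , t , _) = loc s  in i , t
        slot (inj₂ s) = let (i , t , _) = loc′ s in i , not t

        cross : ∀ s s′ → slot (inj₁ s) ≡ slot (inj₂ s′) → Matching (ℕ.suc m)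
        cross s s′ same with loc s | loc′ s′
        cross s s′ refl | i , _ , l | _ , false , l′ =
          location-clash fr′ fr (≢-sym w≢w′) (sym eq) (end-edge sp′ s′) (end-edge sp s) l′ l
        cross s s′ refl | i , _ , l | _ , true  , l′ =
          location-clash fr fr′ w≢w′ eq (end-edge sp s) (end-edge sp′ s′) l l′

        slot-inj₁ : ∀ s s′ → slot (inj₁ s) ≡ slot (inj₁ s′) → s ≡ s′
        slot-inj₁ s s′ same with loc s | loc s′
        slot-inj₁ s s′ refl | _ , _ , l | _ , _ , l′ = injective sp (location-colour l l′ (end-edge sp s) (end-edge sp s′))

        slot-inj₂ : ∀ s s′ → slot (inj₂ s) ≡ slot (inj₂ s′) → s ≡ s′
        slot-inj₂ s s′ same with loc′ s | loc′ s′
        ... | i , t , l | i′ , t′ , l′ with cong proj₁ same | not-injective (cong proj₂ same)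
        ...   | refl | refl = injective sp′ (location-colour l l′ (end-edge sp′ s) (end-edge sp′ s′))

        -- Two of the 2m + 2 edges share one of the 2m slots. At one vertex they would have the same
        -- colour, so they are at different vertices.
        collide : Matching (ℕ.suc m)
        collide with pigeonhole-⊎ (place ∘ slot)
        ... | inj₁ s , inj₁ s′ , x≢y , same = contradiction (cong inj₁ (slot-inj₁ s s′ (place-injective same))) x≢y
        ... | inj₂ s , inj₂ s′ , x≢y , same = contradiction (cong inj₂ (slot-inj₂ s s′ (place-injective same))) x≢y
        ... | inj₁ s , inj₂ s′ , x≢y , same = cross s s′ (place-injective same)
        ... | inj₂ s , inj₁ s′ , x≢y , same = cross s′ s (sym (place-injective same))

      -- At most 3m vertices are ends of matching edges or values of `z`, and `xs` has at most two
      -- more.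
      fresh-vertex : 3 ℕ.* ℕ.suc m ℕ.≤ n → ∀ xs → length xs ℕ.< 3 → ∃ λ w → Fresh w × w ∉ xs
      fresh-vertex 3m+3≤n xs ∣xs∣<3 with fresh (used ++ xs) (subst (ℕ._< n) (sym ∣used++xs∣) room)
        where
        3m+3 : ∀ m → 3 ℕ.* ℕ.suc m ≡ m ℕ.+ (m ℕ.+ m) ℕ.+ 3
        3m+3 = solve-∀
        room : m ℕ.+ (m ℕ.+ m) ℕ.+ length xs ℕ.< n
        room = ℕ.<-≤-trans (ℕ.+-monoʳ-< (m ℕ.+ (m ℕ.+ m)) ∣xs∣<3) (subst (ℕ._≤ n) (3m+3 m) 3m+3≤n)
        used = tabulate a ++ tabulate b ++ tabulate z
        ∣used++xs∣ : length (used ++ xs) ≡ m ℕ.+ (m ℕ.+ m) ℕ.+ length xs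
        ∣used++xs∣ rewrite List.length-++ used {xs} | List.length-++ (tabulate a) {tabulate b ++ tabulate z}
          | List.length-++ (tabulate b) {tabulate z}
          | List.length-tabulate a | List.length-tabulate b | List.length-tabulate z = refl
      ... | w , w∉ = w
        , ( (λ i → (λ { refl → w∉ (∈-++⁺ˡ (∈-++⁺ˡ (∈-tabulate⁺ i))) })
                 , (λ { refl → w∉ (∈-++⁺ˡ (∈-++⁺ʳ (tabulate a) (∈-++⁺ˡ (∈-tabulate⁺ i)))) }))
          , (λ { i refl → w∉ (∈-++⁺ˡ (∈-++⁺ʳ (tabulate a) (∈-++⁺ʳ (tabulate b) (∈-tabulate⁺ i)))) }) )
        , w∉ ∘ ∈-++⁺ʳ _

      -- Of three fresh vertices, two share one of the two sides.
      fresh-pair : 3 ℕ.* ℕ.suc m ℕ.≤ n →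
                   ∃₂ λ w w′ → Fresh w × Fresh w′ × w ≢ w′ × side w ≡ side w′
      fresh-pair 3m+3≤n
        with fresh-vertex 3m+3≤n [] (ℕ.s≤s ℕ.z≤n)
      ... | x , x-fresh , _
        with fresh-vertex 3m+3≤n (x ∷ []) (ℕ.s≤s (ℕ.s≤s ℕ.z≤n))
      ... | y , y-fresh , y∉
        with fresh-vertex 3m+3≤n (y ∷ x ∷ []) ℕ.≤-refl
      ... | v , v-fresh , v∉ with side x Bool.≟ side y | side x Bool.≟ side v
      ... | yes eq | _      = x , y , x-fresh , y-fresh , ≢-sym (y∉ ∘ here) , eq
      ... | no _   | yes eq = x , v , x-fresh , v-fresh , ≢-sym (v∉ ∘ there ∘ here) , eq
      ... | no ≢   | no ≢′  = y , v , y-fresh , v-fresh , ≢-sym (v∉ ∘ here)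
                            , not-injective (trans (sym (¬-not ≢)) (¬-not ≢′))

      locate-all : Continuation F →
                   ∀ {w} → Fresh w → (sp : Spectrum m w) →
                   Matching (ℕ.suc m) ⊎ (∀ s → ∃₂ (Location F w (end sp s)))
      locate-all continue fr sp =
        -- The left summand is an early exit: one edge yielding a larger matching suffices.
        Fin.sequence (Left.applicative (Matching (ℕ.suc m)) 0ℓ) λ s → locate F continue fr (end-edge sp s)

      augment-or-grow :
        Continuation F → 3 ℕ.* ℕ.suc m ℕ.≤ n → (∀ w → m ℕ.< colourDegree G w) → Matching (ℕ.suc m)
      augment-or-grow continue 3m+3≤n degree =
        let (w , w′ , fr , fr′ , w≢w′ , eq) = fresh-pair 3m+3≤n
            sp  = spectrum (degree w)
            sp′ = spectrum (degree w′)
        in [ id , (λ loc → [ id , collide fr fr′ w≢w′ eq sp sp′ loc ]′ (locate-all continue fr′ sp′)) ]′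
             (locate-all continue fr sp)

    -- Induction on the forest and on the matching.

    -- Induction on `d`, the number of indices outside `P`. When it is 0, a grown forest would list
    -- m + 1 distinct elements of `Fin m`.
    improve : ∀ {m} d (F : Forest m) → length (Forest.P F) ℕ.+ d ≡ m → 3 ℕ.* ℕ.suc m ℕ.≤ n →
              (∀ w → m ℕ.< colourDegree G w) → Matching (ℕ.suc m)
    improve {m} ℕ.zero F ∣P∣≡m = augment-or-grow F λ F′ ∣F′∣ → contradiction
      (subst (ℕ._≤ m) (trans ∣F′∣ (cong ℕ.suc (trans (sym (ℕ.+-identityʳ _)) ∣P∣≡m)))
        (Unique⇒length≤ (Forest.P-unique F′)))
      ℕ.1+n≰n
    improve (ℕ.suc d) F ∣P∣+d≡m 3m+3≤n degree = augment-or-grow F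
      (λ F′ ∣F′∣ → improve d F′ (trans (cong (ℕ._+ d) ∣F′∣) (trans (sym (ℕ.+-suc _ d)) ∣P∣+d≡m)) 3m+3≤n degree)
      3m+3≤n degree

    bare : ∀ {m} → Matching m → Fin n → Forest m
    bare M w = record
      { matching = M ; P = [] ; P-unique = [] ; z = const w
      ; z-free = λ () ; z-inj = λ () ; z-edge = λ () ; chains = λ () }

    matching-of-size : ∀ {k} → 3 ℕ.* k ℕ.≤ n → (∀ w → k ℕ.≤ colourDegree G w) →
                       ∀ m → m ℕ.≤ k → Matching m
    matching-of-size 3k≤n degree ℕ.zero m≤k = record
      { edge = λ () ; isEdge = λ () ; apart = λ {} }
    matching-of-size 3k≤n degree (ℕ.suc m) m<k =
      -- The first vertex is the default value of `z` while `P` is empty; it exists because 3(m + 1)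
      -- ≤ n.
      improve m (bare (matching-of-size 3k≤n degree m (ℕ.<⇒≤ m<k)) (Fin.fromℕ< 0<n)) refl 3m+3≤n
        (λ w → ℕ.<-≤-trans m<k (degree w))
      where
      3m+3≤n = ℕ.≤-trans (ℕ.*-monoʳ-≤ 3 m<k) 3k≤n
      0<n : 0 ℕ.< n
      0<n = ℕ.<-≤-trans ℕ.z<s 3m+3≤n

-- From the rational bound on the order to 3k ≤ n.

p≤p+q : ∀ p {q} → 0ℚ < q → p ≤ p + q
p≤p+q p {q} 0<q = subst (_≤ p + q) (ℚ.+-identityʳ p) (ℚ.+-monoʳ-≤ p (ℚ.<⇒≤ 0<q))

-- Dropping the nonnegative terms εk and 1/ε² gives 3k ≤ n over `ℚ`. Among unnormalised rationals
-- with denominator 1 this is an inequality of integers.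
order-bound : ∀ ε (ε>0 : 0ℚ < ε) k n →
              (+ 3 / 1 + ε) * (+ k / 1) + invSq ε ε>0 ≤ + n / 1 → 3 ℕ.* k ℕ.≤ n
order-bound ε ε>0 k n bound = ℤ.drop‿+≤+ (subst₂ ℤ._≤_ lhs rhs (ℚᵘ.drop-*≤* step))
  where
  instance
    ε-pos : ℚ.Positive ε
    ε-pos = ℚ.positive ε>0
    k-nonNeg : ℚ.NonNegative (+ k / 1)
    k-nonNeg = ℚ.normalize-nonNeg k 1
  i : ℚ
  i = (ℚ.1/ ε) {{ℚ.pos⇒nonZero ε}}
  instance
    i-pos : ℚ.Positive i
    i-pos = ℚ.1/pos⇒pos ε
    i²-pos : ℚ.Positive (i * i)
    i²-pos = ℚ.pos*pos⇒pos i i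
  3k≤n : + 3 / 1 * (+ k / 1) ≤ + n / 1
  3k≤n = ℚ.≤-trans
    (ℚ.*-monoʳ-≤-nonNeg (+ k / 1) (p≤p+q (+ 3 / 1) ε>0))
    (ℚ.≤-trans (p≤p+q _ (ℚ.positive⁻¹ (i * i))) bound)
  step : ℚᵘ.mkℚᵘ (+ 3) 0 ℚᵘ.* ℚᵘ.mkℚᵘ (+ k) 0 ℚᵘ.≤ ℚᵘ.mkℚᵘ (+ n) 0
  step = begin
    ℚᵘ.mkℚᵘ (+ 3) 0 ℚᵘ.* ℚᵘ.mkℚᵘ (+ k) 0      ≃⟨ ℚᵘ.*-cong (ℚ.toℚᵘ-fromℚᵘ (ℚᵘ.mkℚᵘ (+ 3) 0)) (ℚ.toℚᵘ-fromℚᵘ (ℚᵘ.mkℚᵘ (+ k) 0)) ⟨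
    ℚ.toℚᵘ (+ 3 / 1) ℚᵘ.* ℚ.toℚᵘ (+ k / 1)    ≃⟨ ℚ.toℚᵘ-homo-* (+ 3 / 1) (+ k / 1) ⟨
    ℚ.toℚᵘ (+ 3 / 1 * (+ k / 1))              ≤⟨ ℚ.toℚᵘ-mono-≤ 3k≤n ⟩
    ℚ.toℚᵘ (+ n / 1)                          ≃⟨ ℚ.toℚᵘ-fromℚᵘ (ℚᵘ.mkℚᵘ (+ n) 0) ⟩
    ℚᵘ.mkℚᵘ (+ n) 0                           ∎
    where open ℚᵘ.≤-Reasoning
  lhs : + 3 ℤ.* + k ℤ.* + 1 ≡ + (3 ℕ.* k)
  lhs = trans (ℤ.*-identityʳ _) (sym (ℤ.pos-* 3 k))
  rhs : + n ℤ.* + 1 ≡ + n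
  rhs = ℤ.*-identityʳ _

theorem1p2 : (ε : ℚ) (ε>0 : 0ℚ < ε) → ε ≤ + 1 / 2 → (k n : ℕ) →
    ((+ 3 / 1 + ε) * (+ k / 1) + invSq ε ε>0 ≤ + n / 1) →
    (G : ECGraph n) → IsBipartite G → MinColourDegreeAtLeast G k →
    RainbowMatching G k
theorem1p2 ε ε>0 _ k n bound G (side , bipartite) degree =
  toRainbowMatching (matching-of-size (order-bound ε ε>0 k n bound) degree k ℕ.≤-refl)
  where
  open Rainbow G
  open Bipartite side bipartite
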